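{- Let $(X,x_0)$ and $(Y,y_0)$ be pointed finite sets, let $\alpha\in\mathrm{Part}(X)$ and $\beta\in\mathrm{Part}(Y)$, and let $Z$ and $\alpha\odot\beta\in\mathrm{Part}(Z)$ be as defined in the context. Then \[ \alpha\odot\beta=\mathbf 1_Z\quad\Longleftrightarrow\quad \alpha=\mathbf 1_X\ \text{ or }\ \beta=\mathbf 1_Y . \]
   Context: For a finite set $W$, $\mathrm{Part}(W)$ is the set of partitions of $W$, ordered by refinement ($\pi\preceq\sigma$ iff every block of $\pi$ is contained in a block of $\sigma$). The join $\pi\vee\sigma$ is the finest partition coarser than both; $\mathbf 1_W=\{W\}$ is the one-block partition. Pointed lifts. Let $X^\circ=X\setminus\{x_0\}$, $Y^\circ=Y\setminus\{y_0\}$ and $Z=\{z_0\}\cup(X^\circ\times Y^\circ)$, where $z_0$ is a new point. For $\alpha\in\mathrm{Part}(X)$ let $A_0$ be the block of $\alpha$ containing $x_0$; $L_X(\alpha)\in\mathrm{Part}(Z)$ is the partition whose blocks are $\{z_0\}\cup\bigl((A_0\setminus\{x_0\})\times Y^\circ\bigr)$ and the sets $A\times\{y\}$ for every block $A\in\alpha\setminus\{A_0\}$ and every $y\in Y^\circ$. Symmetrically, for $\beta\in\mathrm{Part}(Y)$ with $B_0$ the block containing $y_0$, $L_Y(\beta)\in\mathrm{Part}(Z)$ has blocks $\{z_0\}\cup\bigl(X^\circ\times(B_0\setminus\{y_0\})\bigr)$ and $\{x\}\times B$ for every $B\in\beta\setminus\{B_0\}$ and every $x\in X^\circ$. Pointed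 partition disjunctive composition: $\alpha\odot\beta:=L_X(\alpha)\vee L_Y(\beta)\in\mathrm{Part}(Z)$. -}

module Defs where

open import Algebra.Core using (Op₂)
open import Data.Empty using (⊥; ⊥-elim)
open import Data.Fin.Base using (Fin; zero; suc; punchIn; punchOut)
open import Data.Fin.Properties as Fin
  using (punchIn-punchOut; punchInᵢ≢i; punchOut-cong; punchOut-punchIn; *↔×)
open import Data.List.Base using (List; []; _∷_; map; allFin; cartesianProduct)
open import Data.List.Membership.Propositional using (_∈_)
open import Data.List.Membership.Propositional.Properties
  using (∈-allFin; ∈-map⁺; ∈-cartesianProduct⁺)
open import Data.List.Relation.Unary.Any using (here; there)
open import Data.Maybe.Base using (Maybe; just; nothing)
open import Data.Nat.Base using (zero; suc)
open import Data.Product.Base using (∃; ∃-syntax; _×_; _,_; proj₁; proj₂)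
open import Data.Sum.Base using (_⊎_; inj₁; inj₂)
open import Data.Unit.Base using (⊤; tt)
open import Function.Base using (_∘_; case_of_)
open import Function.Bundles using (_↔_; Inverse; mk↔ₛ′)
open import Function.Construct.Composition using (_↔-∘_)
open import Function.Construct.Symmetry using (↔-sym)
open import Data.Product.Function.NonDependent.Propositional using (_×-↔_)
open import Function.Properties.Inverse using (↔⇒↣)
open import Level using (0ℓ)
open import Relation.Binary.Core using (Rel)
open import Relation.Binary.Definitions using (DecidableEquality)
open import Relation.Binary.Lattice.Definitions using (Supremum)
open import Relation.Binary.Lattice.Structures using (IsJoinSemilattice)
open import Relation.Binary.PropositionalEquality
  using (_≡_; _≢_; refl; sym; trans; cong; subst)
open import Relation.Binary.Structures using (IsPartialOrder)
open import Relation.Nullary.Decidable.Core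
  using (Dec; yes; no; map′; _×-dec_; _⊎-dec_)
open import Relation.Nullary.Decidable using (via-injection)
open import Relation.Unary using (Pred; Decidable; _⊆_; _≐_)

Finite : Set → Set
Finite W = ∃[ n ] (W ↔ Fin n)

infixl 8 _∖_

-- Any two proofs of w ≢ w₀ are definitionally equal, so W ∖ w₀ really is
-- the subset W \ {w₀}.
_∖_ : (W : Set) → W → Set
W ∖ w₀ = ∃[ w ] w ≢ w₀

-- A set of nonempty, pairwise disjoint, covering subsets of W.  The blocks
-- are indexed without repetition: by `nonempty` and `disjoint`, distinct
-- indices label distinct blocks.  Membership in a block is decidable, as it
-- is for every subset of a finite set classically.
record Part (W : Set) : Set₁ where
  field
    Index    : Set
    block    : Index → Pred W 0ℓ
    block?   : ∀ i → Decidable (block i)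
    nonempty : ∀ i → ∃[ w ] block i w
    cover    : ∀ w → ∃[ i ] block i w
    disjoint : ∀ {i j w} → block i w → block j w → i ≡ j

  index-≟ : DecidableEquality Index
  index-≟ i j with nonempty i
  ... | w , w∈i = map′ (disjoint w∈i) (λ { refl → w∈i }) (block? j w)

open Part

infix 4 _⪯_ _≈_

_⪯_ : ∀ {W} → Rel (Part W) 0ℓ
π ⪯ σ = ∀ i → ∃[ j ] block π i ⊆ block σ j

_≈_ : ∀ {W} → Rel (Part W) 0ℓ
π ≈ σ = (∀ i → ∃[ j ] block π i ≐ block σ j) × (∀ j → ∃[ i ] block π i ≐ block σ j)

-- The point of W is needed because the empty set is not a block.
𝟏 : ∀ {W} → W → Part W
𝟏 w₀ = record
  { Index    = ⊤
  ; block    = λ _ _ → ⊤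
  ; block?   = λ _ _ → yes tt
  ; nonempty = λ _ → w₀ , tt
  ; cover    = λ _ → tt , tt
  ; disjoint = λ _ _ → refl
  }

⪯-isPartialOrder : ∀ {W} → IsPartialOrder (_≈_ {W}) _⪯_
⪯-isPartialOrder {W} = record
  { isPreorder = record
    { isEquivalence = record
      { refl  = (λ i → i , (λ p → p) , (λ p → p)) , (λ i → i , (λ p → p) , (λ p → p))
      ; sym   = λ { (f , g) →
                  (λ i → let (j , p , q) = g i in j , q , p) ,
                  (λ i → let (j , p , q) = f i in j , q , p) }
      ; trans = λ { (f , g) (f′ , g′) →
                  (λ i → let (j , p , q) = f i ; (k , r , s) = f′ j in k , r ∘ p , q ∘ s) ,
                  (λ k → let (j , r , s) = g′ k ; (i , p , q) = g j in i , r ∘ p , q ∘ s) }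
      }
    ; reflexive = λ { (f , _) i → let (j , p , _) = f i in j , p }
    ; trans     = λ f g i → let (j , p) = f i ; (k , q) = g j in k , q ∘ p
    }
  ; antisym = λ {π} {σ} f g → half π σ f g ,
      λ j → let (i , p , q) = half σ π g f j in i , q , p
  }
  where
  half : ∀ (π σ : Part W) → π ⪯ σ → σ ⪯ π → ∀ i → ∃[ j ] block π i ≐ block σ j
  half π σ f g i with nonempty π i | f i
  ... | w , w∈i | j , i⊆j with g j
  ... | i′ , j⊆i′ with disjoint π w∈i (j⊆i′ (i⊆j w∈i))
  ... | refl = j , i⊆j , j⊆i′

infix 4 _⊢_∼_

_⊢_∼_ : ∀ {W} → Part W → W → W → Set
π ⊢ u ∼ v = ∃[ i ] block π i u × block π i v

∼? : ∀ {W} (π : Part W) u v → Dec (π ⊢ u ∼ v)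
∼? π u v with cover π u
... | i , u∈i = map′ (λ v∈i → i , u∈i , v∈i)
  (λ { (j , u∈j , v∈j) → subst (λ k → block π k v) (disjoint π u∈j u∈i) v∈j }) (block? π i v)

⪯⇒∼ : ∀ {W} {π σ : Part W} → π ⪯ σ → ∀ {u v} → π ⊢ u ∼ v → σ ⊢ u ∼ v
⪯⇒∼ f (i , u∈i , v∈i) = let (j , p) = f i in j , p u∈i , p v∈i

∼⇒⪯ : ∀ {W} {π σ : Part W} → (∀ {u v} → π ⊢ u ∼ v → σ ⊢ u ∼ v) → π ⪯ σ
∼⇒⪯ {π = π} {σ} f i with nonempty π i
... | w , w∈i with cover σ w
... | j , w∈j = j , λ {v} v∈i → case f (i , w∈i , v∈i) of λ
  { (k , w∈k , v∈k) → subst (λ l → block σ l v) (disjoint σ w∈k w∈j) v∈k }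

-- The union of blocks i and j is labelled i, and the index j is dropped.
mergeBlocks : ∀ {W} (π : Part W) {i j : Index π} → i ≢ j → Part W
mergeBlocks π {i} {j} i≢j = record
  { Index    = Index π ∖ j
  ; block    = blk
  ; block?   = λ (k , _) w → block? π k w ⊎-dec (index-≟ π k i ×-dec block? π j w)
  ; nonempty = λ (k , _) → let (w , w∈k) = nonempty π k in w , inj₁ w∈k
  ; cover    = covered
  ; disjoint = λ {k} {l} → dis k l
  }
  where
  ∖-≡ : ∀ {k l : Index π ∖ j} → proj₁ k ≡ proj₁ l → k ≡ l
  ∖-≡ refl = refl
  blk : Index π ∖ j → Pred _ 0ℓ
  blk (k , _) w = block π k w ⊎ (k ≡ i × block π j w)
  dis : ∀ k l {w} → blk k w → blk l w → k ≡ l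
  dis _         _         (inj₁ p)       (inj₁ q)       = ∖-≡ (disjoint π p q)
  dis (k , k≢j) _         (inj₁ p)       (inj₂ (_ , q)) = ⊥-elim (k≢j (disjoint π p q))
  dis _         (l , l≢j) (inj₂ (_ , p)) (inj₁ q)       = ⊥-elim (l≢j (disjoint π q p))
  dis _         _         (inj₂ (p , _)) (inj₂ (q , _)) = ∖-≡ (trans p (sym q))
  covered : ∀ w → ∃[ k ] blk k w
  covered w with cover π w
  ... | k , w∈k with index-≟ π k j
  ... | yes refl = (i , i≢j) , inj₂ (refl , w∈k)
  ... | no k≢j   = (k , k≢j) , inj₁ w∈k

-- The finest partition coarser than π in which u and v share a block.
merge : ∀ {W} → W → W → Part W → Part W
merge u v π with index-≟ π (proj₁ (cover π u)) (proj₁ (cover π v))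
... | yes _   = π
... | no  i≢j = mergeBlocks π i≢j

⪯-merge : ∀ {W} u v (π : Part W) → π ⪯ merge u v π
⪯-merge u v π with index-≟ π (proj₁ (cover π u)) (proj₁ (cover π v))
... | yes _   = λ i → i , λ p → p
... | no  i≢j = into
  where
  into : π ⪯ mergeBlocks π i≢j
  into k with index-≟ π k (proj₁ (cover π v))
  ... | yes refl = (_ , i≢j) , λ p → inj₂ (refl , p)
  ... | no k≢j   = (k , k≢j) , λ p → inj₁ p

merge-∼ : ∀ {W} u v (π : Part W) → merge u v π ⊢ u ∼ v
merge-∼ u v π with index-≟ π (proj₁ (cover π u)) (proj₁ (cover π v))
... | yes i≡j = _ , proj₂ (cover π u) ,
                subst (λ k → block π k v) (sym i≡j) (proj₂ (cover π v))
... | no  i≢j = (_ , i≢j) , inj₁ (proj₂ (cover π u)) , inj₂ (refl , proj₂ (cover π v))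

merge-least : ∀ {W} u v (π γ : Part W) → π ⪯ γ → γ ⊢ u ∼ v → merge u v π ⪯ γ
merge-least u v π γ f (k , u∈k , v∈k)
  with index-≟ π (proj₁ (cover π u)) (proj₁ (cover π v))
... | yes _   = f
... | no  i≢j = λ (l , _) → let (m , p) = f l in m , λ
  { (inj₁ q)          → p q
  ; {w} (inj₂ (refl , q)) →
      let (n , r) = f (proj₁ (cover π v)) in
      subst (λ o → block γ o w)
        (trans (disjoint γ (r (proj₂ (cover π v))) v∈k)
               (disjoint γ u∈k (p (proj₂ (cover π u)))))
        (r q) }

mergeAlong : ∀ {W} → Part W → List (W × W) → Part W → Part W
mergeAlong σ []             π = π
mergeAlong σ ((u , v) ∷ ps) π with ∼? σ u v
... | yes _ = merge u v (mergeAlong σ ps π)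
... | no  _ = mergeAlong σ ps π

module _ {W : Set} where
  open IsPartialOrder (⪯-isPartialOrder {W}) using () renaming (refl to ⪯-refl; trans to ⪯-trans)

  ⪯-mergeAlong : ∀ (σ : Part W) ps π → π ⪯ mergeAlong σ ps π
  ⪯-mergeAlong σ [] π = ⪯-refl {π}
  ⪯-mergeAlong σ ((u , v) ∷ ps) π with ∼? σ u v
  ... | yes _ = ⪯-trans {π} {ρ} {merge u v ρ} (⪯-mergeAlong σ ps π) (⪯-merge u v ρ)
    where ρ = mergeAlong σ ps π
  ... | no  _ = ⪯-mergeAlong σ ps π

  mergeAlong-∼ : ∀ (σ : Part W) ps π {u v} → (u , v) ∈ ps → σ ⊢ u ∼ v →
                 mergeAlong σ ps π ⊢ u ∼ v
  mergeAlong-∼ σ ((u , v) ∷ ps) π (here refl) u∼v with ∼? σ u v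
  ... | yes _ = merge-∼ u v (mergeAlong σ ps π)
  ... | no ¬p = ⊥-elim (¬p u∼v)
  mergeAlong-∼ σ ((u , v) ∷ ps) π (there m) u∼v with ∼? σ u v
  ... | yes _ = ⪯⇒∼ {π = ρ} {merge u v ρ} (⪯-merge u v ρ) (mergeAlong-∼ σ ps π m u∼v)
    where ρ = mergeAlong σ ps π
  ... | no  _ = mergeAlong-∼ σ ps π m u∼v

  mergeAlong-least : ∀ (σ : Part W) ps π γ → π ⪯ γ → σ ⪯ γ → mergeAlong σ ps π ⪯ γ
  mergeAlong-least σ [] π γ f g = f
  mergeAlong-least σ ((u , v) ∷ ps) π γ f g with ∼? σ u v
  ... | yes u∼v = merge-least u v (mergeAlong σ ps π) γ (mergeAlong-least σ ps π γ f g)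
                    (⪯⇒∼ {π = σ} {γ} g u∼v)
  ... | no  _   = mergeAlong-least σ ps π γ f g

module Join {W : Set} (finite : Finite W) where

  private
    module W↔Fin = Inverse (proj₂ finite)

  elements : List W
  elements = map W↔Fin.from (allFin _)

  ∈-elements : ∀ w → w ∈ elements
  ∈-elements w = subst (_∈ elements) (W↔Fin.strictlyInverseʳ w)
                   (∈-map⁺ W↔Fin.from (∈-allFin (W↔Fin.to w)))

  pairs : List (W × W)
  pairs = cartesianProduct elements elements

  infixr 6 _∨_

  -- Merge the blocks of π that are met by a common block of σ;
  -- `∨-supremum` characterises the result.
  _∨_ : Op₂ (Part W)
  π ∨ σ = mergeAlong σ pairs π

  ∨-supremum : Supremum _⪯_ _∨_
  ∨-supremum π σ =
    ⪯-mergeAlong σ pairs π ,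
    ∼⇒⪯ {π = σ} {π ∨ σ}
      (mergeAlong-∼ σ pairs π (∈-cartesianProduct⁺ (∈-elements _) (∈-elements _))) ,
    mergeAlong-least σ pairs π

  ∨-isJoinSemilattice : IsJoinSemilattice _≈_ _⪯_ _∨_
  ∨-isJoinSemilattice = record
    { isPartialOrder = ⪯-isPartialOrder
    ; supremum       = ∨-supremum
    }

finite⇒≟ : ∀ {W} → Finite W → DecidableEquality W
finite⇒≟ (_ , W↔Fin) = via-injection (↔⇒↣ W↔Fin) Fin._≟_

∖-finite : ∀ {W} → Finite W → (w₀ : W) → Finite (W ∖ w₀)
∖-finite (zero , f) w₀ = case Inverse.to f w₀ of λ ()
∖-finite {W} (suc n , f) w₀ = n , mk↔ₛ′ to′ from′ to∘from from∘to
  where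
  open Inverse f
  to′ : W ∖ w₀ → Fin n
  to′ (w , w≢w₀) = punchOut {i = to w₀} {j = to w} λ eq →
    w≢w₀ (trans (sym (strictlyInverseʳ w)) (trans (cong from (sym eq)) (strictlyInverseʳ w₀)))
  from′ : Fin n → W ∖ w₀
  from′ k = from (punchIn (to w₀) k) , λ eq →
    punchInᵢ≢i (to w₀) k (trans (sym (strictlyInverseˡ _)) (cong to eq))
  to∘from : ∀ k → to′ (from′ k) ≡ k
  to∘from k = trans (punchOut-cong (to w₀) (strictlyInverseˡ _)) (punchOut-punchIn (to w₀))
  ∖-≡ : ∀ {u v : W ∖ w₀} → proj₁ u ≡ proj₁ v → u ≡ v
  ∖-≡ refl = refl
  from∘to : ∀ w → from′ (to′ w) ≡ w
  from∘to (w , _) = ∖-≡ (trans (cong from (punchIn-punchOut _)) (strictlyInverseʳ w))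

×-finite : ∀ {V W} → Finite V → Finite W → Finite (V × W)
×-finite (_ , f) (_ , g) = _ , (↔-sym *↔× ↔-∘ (f ×-↔ g))

Maybe-finite : ∀ {W} → Finite W → Finite (Maybe W)
Maybe-finite {W} (n , f) = suc n , mk↔ₛ′ to′ from′
  (λ { zero → refl ; (suc k) → cong suc (strictlyInverseˡ k) })
  (λ { nothing → refl ; (just w) → cong just (strictlyInverseʳ w) })
  where
  open Inverse f
  to′ : Maybe W → Fin (suc n)
  to′ nothing  = zero
  to′ (just w) = suc (to w)
  from′ : Fin (suc n) → Maybe W
  from′ zero    = nothing
  from′ (suc k) = just (from k)

module PointedLift {X Y : Set} (finX : Finite X) (x₀ : X) (finY : Finite Y) (y₀ : Y) where

  X° Y° Z : Set
  X° = X ∖ x₀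
  Y° = Y ∖ y₀
  Z  = Maybe (X° × Y°)

  z₀ : Z
  z₀ = nothing

  finZ : Finite Z
  finZ = Maybe-finite (×-finite (∖-finite finX x₀) (∖-finite finY y₀))

  -- The index `nothing` labels the block of z₀; `just (i , y)` labels A × {y}
  -- for A = block α i.
  L-X : Part X → Part Z
  L-X α = record
    { Index    = Maybe (Index α ∖ i₀ × Y°)
    ; block    = blk
    ; block?   = blk?
    ; nonempty = λ
      { nothing → nothing , tt
      ; (just ((i , i≢i₀) , y)) → case nonempty α i of λ
          { (x , x∈i) → just ((x , λ { refl → i≢i₀ (disjoint α x∈i x₀∈A₀) }) , y) , x∈i , refl } }
    ; cover    = cov
    ; disjoint = λ {i} {j} {z} → dis i j z
    }
    where
    i₀ : Index α
    i₀ = proj₁ (cover α x₀)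
    x₀∈A₀ : block α i₀ x₀
    x₀∈A₀ = proj₂ (cover α x₀)
    blk : Maybe (Index α ∖ i₀ × Y°) → Pred Z 0ℓ
    blk nothing              nothing               = ⊤
    blk nothing              (just ((x , _) , _))  = block α i₀ x
    blk (just _)             nothing               = ⊥
    blk (just ((i , _) , y)) (just ((x , _) , y′)) = block α i x × y′ ≡ y
    blk? : ∀ k → Decidable (blk k)
    blk? nothing              nothing               = yes tt
    blk? nothing              (just ((x , _) , _))  = block? α i₀ x
    blk? (just _)             nothing               = no λ ()
    blk? (just ((i , _) , y)) (just ((x , _) , y′)) =
      block? α i x ×-dec finite⇒≟ (∖-finite finY y₀) y′ y
    cov : ∀ z → ∃[ k ] blk k z
    cov nothing = nothing , tt
    cov (just ((x , _) , y)) with cover α x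
    ... | i , x∈i with index-≟ α i i₀
    ... | yes refl = nothing , x∈i
    ... | no i≢i₀  = just ((i , i≢i₀) , y) , x∈i , refl
    dis : ∀ k l z → blk k z → blk l z → k ≡ l
    dis nothing nothing _ _ _ = refl
    dis nothing (just ((_ , l≢i₀) , _)) (just _) p (q , _) = ⊥-elim (l≢i₀ (disjoint α q p))
    dis (just ((_ , k≢i₀) , _)) nothing (just _) (p , _) q = ⊥-elim (k≢i₀ (disjoint α p q))
    dis (just _) (just _) (just _) (p , refl) (q , refl) with disjoint α p q
    ... | refl = refl

  -- The index `nothing` labels the block of z₀; `just (x , j)` labels {x} × B
  -- for B = block β j.
  L-Y : Part Y → Part Z
  L-Y β = record
    { Index    = Maybe (X° × Index β ∖ j₀)
    ; block    = blk
    ; block?   = blk?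
    ; nonempty = λ
      { nothing → nothing , tt
      ; (just (x , (j , j≢j₀))) → case nonempty β j of λ
          { (y , y∈j) → just (x , (y , λ { refl → j≢j₀ (disjoint β y∈j y₀∈B₀) })) , refl , y∈j } }
    ; cover    = cov
    ; disjoint = λ {i} {j} {z} → dis i j z
    }
    where
    j₀ : Index β
    j₀ = proj₁ (cover β y₀)
    y₀∈B₀ : block β j₀ y₀
    y₀∈B₀ = proj₂ (cover β y₀)
    blk : Maybe (X° × Index β ∖ j₀) → Pred Z 0ℓ
    blk nothing              nothing               = ⊤
    blk nothing              (just (_ , (y , _)))  = block β j₀ y
    blk (just _)             nothing               = ⊥
    blk (just (x , (j , _))) (just (x′ , (y , _))) = x′ ≡ x × block β j y
    blk? : ∀ k → Decidable (blk k)
    blk? nothing              nothing               = yes tt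
    blk? nothing              (just (_ , (y , _)))  = block? β j₀ y
    blk? (just _)             nothing               = no λ ()
    blk? (just (x , (j , _))) (just (x′ , (y , _))) =
      finite⇒≟ (∖-finite finX x₀) x′ x ×-dec block? β j y
    cov : ∀ z → ∃[ k ] blk k z
    cov nothing = nothing , tt
    cov (just (x , (y , _))) with cover β y
    ... | j , y∈j with index-≟ β j j₀
    ... | yes refl = nothing , y∈j
    ... | no j≢j₀  = just (x , (j , j≢j₀)) , refl , y∈j
    dis : ∀ k l z → blk k z → blk l z → k ≡ l
    dis nothing nothing _ _ _ = refl
    dis nothing (just (_ , (_ , l≢j₀))) (just _) p (_ , q) = ⊥-elim (l≢j₀ (disjoint β q p))
    dis (just (_ , (_ , k≢j₀))) nothing (just _) (_ , p) q = ⊥-elim (k≢j₀ (disjoint β p q))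
    dis (just _) (just _) (just _) (refl , p) (refl , q) with disjoint β p q
    ... | refl = refl

  open Join finZ

  infixr 7 _⊙_

  _⊙_ : Part X → Part Y → Part Z
  α ⊙ β = L-X α ∨ L-Y β

{-# OPTIONS --safe #-}
-- If α and β both have a block missing the base point, say A and B, then
-- A × B is a union of blocks of L-X α and of L-Y β which misses z₀, so
-- {A × B , Z ∖ (A × B)} is an upper bound of the two lifts other than 𝟏.

module Submission where

open import Defs
open import Data.Bool.Base using (Bool; true; false)
open import Data.Bool.Properties as Bool using ()
open import Data.Empty using (⊥)
open import Data.Fin.Properties using (all?; ¬∀⟶∃¬)
open import Data.Maybe.Base using (just; nothing)
open import Data.Product.Base using (∃-syntax; _×_; _,_; proj₁; proj₂)
open import Data.Sum.Base using (_⊎_; inj₁; inj₂; [_,_])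
open import Data.Unit.Base using (tt)
open import Function.Bundles using (_⇔_; mk⇔; Inverse)
open import Level using (0ℓ)
open import Relation.Binary.PropositionalEquality using (_≡_; refl; sym; trans; subst)
open import Relation.Binary.Structures using (IsPartialOrder)
open import Relation.Nullary using (¬_; contradiction)
open import Relation.Nullary.Decidable
  using (Dec; yes; no; does; does-⇔; dec-true; dec-false; _×-dec_)
open import Relation.Unary using (Pred; Decidable)

open Part

module _ {W : Set} (π : Part W) where

  block-closed : ∀ {i u v} → block π i u → π ⊢ u ∼ v → block π i v
  block-closed {v = v} u∈i (j , u∈j , v∈j) = subst (λ k → block π k v) (disjoint π u∈j u∈i) v∈j

  ∼-sym : ∀ {u v} → π ⊢ u ∼ v → π ⊢ v ∼ u
  ∼-sym (i , u∈i , v∈i) = i , v∈i , u∈i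

  ∼⇒≈𝟏 : ∀ w₀ → (∀ w → π ⊢ w₀ ∼ w) → π ≈ 𝟏 w₀
  ∼⇒≈𝟏 w₀ connected = IsPartialOrder.antisym ⪯-isPartialOrder {π} {𝟏 w₀} (λ _ → tt , λ _ → tt)
    -- The block chosen for `w₀` alone serves every `w`, because two blocks sharing `w₀` coincide.
    (λ _ → proj₁ (connected w₀) , λ {w} _ →
      block-closed (proj₁ (proj₂ (connected w₀))) (connected w))

  ≈𝟏⇒∼ : ∀ w₀ → π ≈ 𝟏 w₀ → ∀ u v → π ⊢ u ∼ v
  ≈𝟏⇒∼ _ (_ , g) u v = let (i , _ , all) = g tt in i , all tt , all tt

  -- A constructive case split: by finiteness it is decidable whether the block of `w₀` is
  -- everything, and a point outside it lies in a block with another index.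
  ≈𝟏-or-otherBlock : Finite W → ∀ w₀ → π ≈ 𝟏 w₀ ⊎ Index π ∖ proj₁ (cover π w₀)
  ≈𝟏-or-otherBlock (n , W↔Fin) w₀ = search (all? λ k → block? π i₀ (from k))
    where
    open Inverse W↔Fin
    i₀ = proj₁ (cover π w₀)
    search : Dec (∀ k → block π i₀ (from k)) → π ≈ 𝟏 w₀ ⊎ Index π ∖ i₀
    search (yes all) = inj₁ (∼⇒≈𝟏 w₀ λ w →
      i₀ , proj₂ (cover π w₀) , subst (block π i₀) (strictlyInverseʳ w) (all (to w)))
    search (no ¬all) =
      let (k , k∉i₀) = ¬∀⟶∃¬ n (λ k → block π i₀ (from k)) (λ k → block? π i₀ (from k)) ¬all
          (i , k∈i) = cover π (from k)
      in inj₂ (i , λ i≡i₀ → k∉i₀ (subst (λ j → block π j (from k)) i≡i₀ k∈i))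

-- One implication suffices: `_⊢_∼_` is symmetric, so the complement of `P` is closed as well.
Saturated : ∀ {W} → Pred W 0ℓ → Part W → Set
Saturated P π = ∀ {u v} → π ⊢ u ∼ v → P u → P v

module _ {W : Set} {P : Pred W 0ℓ} (P? : Decidable P) {u v : W} (Pu : P u) (¬Pv : ¬ P v) where

  -- The label of a block is the truth value of `P?` on it, so disjointness is transitivity of
  -- equality; `u` and `v` keep both blocks nonempty.
  dichotomy : Part W
  dichotomy = record
    { Index    = Bool
    ; block    = λ b w → does (P? w) ≡ b
    ; block?   = λ b w → does (P? w) Bool.≟ b
    ; nonempty = λ { true → u , dec-true (P? u) Pu ; false → v , dec-false (P? v) ¬Pv }
    ; cover    = λ w → does (P? w) , refl
    ; disjoint = λ p q → trans (sym p) q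
    }

  saturated⇒⪯dichotomy : ∀ π → Saturated P π → π ⪯ dichotomy
  saturated⇒⪯dichotomy π sat = ∼⇒⪯ {π = π} {dichotomy} λ {w} {w′} w∼w′ →
    -- The common label is `does (P? w)`; the converse implication is saturation along the reversed
    -- relation.
    _ , refl , does-⇔ (mk⇔ (sat (∼-sym π w∼w′)) (sat w∼w′)) (P? w′) (P? w)

  dichotomy-separates : ¬ (dichotomy ⊢ u ∼ v)
  dichotomy-separates (_ , p , q)
    with () ← trans (sym (dec-true (P? u) Pu)) (trans p (trans (sym q) (dec-false (P? v) ¬Pv)))

  -- The join is the least upper bound, hence lies below `dichotomy`; if it were `𝟏`, then `u` and
  -- `v` would share a block there.
  saturated⇒∨-≉𝟏 : (finW : Finite W) → let open Join finW in
    ∀ π σ w₀ → Saturated P π → Saturated P σ → ¬ (π ∨ σ ≈ 𝟏 w₀)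
  saturated⇒∨-≉𝟏 finW π σ w₀ satπ satσ eq = dichotomy-separates
    (⪯⇒∼ {π = π ∨ σ} {dichotomy}
      (proj₂ (proj₂ (∨-supremum π σ)) dichotomy
        (saturated⇒⪯dichotomy π satπ) (saturated⇒⪯dichotomy σ satσ))
      (≈𝟏⇒∼ (π ∨ σ) w₀ eq u v))
    where open Join finW

module _ {X Y : Set} (finX : Finite X) (x₀ : X) (finY : Finite Y) (y₀ : Y) where
  open PointedLift finX x₀ finY y₀
  open Join finZ

  -- If `α` has a single block, that block contains all of `X°`, so the block of `z₀` in the lift
  -- swallows every pair.
  L-X-𝟏 : ∀ α → α ≈ 𝟏 x₀ → ∀ z → L-X α ⊢ z₀ ∼ z
  L-X-𝟏 α eq nothing              = nothing , tt , tt
  L-X-𝟏 α eq (just ((x , _) , _)) =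
    nothing , tt , block-closed α (proj₂ (cover α x₀)) (≈𝟏⇒∼ α x₀ eq x₀ x)

  L-Y-𝟏 : ∀ β → β ≈ 𝟏 y₀ → ∀ z → L-Y β ⊢ z₀ ∼ z
  L-Y-𝟏 β eq nothing              = nothing , tt , tt
  L-Y-𝟏 β eq (just (_ , (y , _))) =
    nothing , tt , block-closed β (proj₂ (cover β y₀)) (≈𝟏⇒∼ β y₀ eq y₀ y)

  module _ (α : Part X) (β : Part Y) where

    Rectangle : Index α → Index β → Pred Z 0ℓ
    Rectangle i j nothing                    = ⊥
    Rectangle i j (just ((x , _) , (y , _))) = block α i x × block β j y

    rectangle? : ∀ i j → Decidable (Rectangle i j)
    rectangle? i j nothing                    = no λ ()
    rectangle? i j (just ((x , _) , (y , _))) = block? α i x ×-dec block? β j y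

    -- The two blocks miss the base points, so none of their points is lost in passing to `X°` and
    -- `Y°`.
    rectangle-nonempty : ((i , _) : Index α ∖ proj₁ (cover α x₀))
                         ((j , _) : Index β ∖ proj₁ (cover β y₀)) → ∃[ z ] Rectangle i j z
    rectangle-nonempty (i , i≢i₀) (j , j≢j₀) =
      let (x , x∈i) = nonempty α i
          (y , y∈j) = nonempty β j
      in just ((x , λ x≡x₀ → i≢i₀ (disjoint α (subst (block α i) x≡x₀ x∈i) (proj₂ (cover α x₀)))) ,
               (y , λ y≡y₀ → j≢j₀ (disjoint β (subst (block β j) y≡y₀ y∈j) (proj₂ (cover β y₀))))) ,
         x∈i , y∈j

    -- A point of the rectangle cannot lie in the lifted block of `z₀`, as its first coordinate
    -- would be in two blocks of `α`. Every other lifted block fixes the second coordinate and moves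
    -- the first within one block of `α`.
    rectangle-saturated-L-X : ((i , _) : Index α ∖ proj₁ (cover α x₀)) →
                              ∀ j → Saturated (Rectangle i j) (L-X α)
    rectangle-saturated-L-X (i , i≢i₀) j {just _} (nothing , x∈i₀ , _) (x∈i , _) =
      contradiction (disjoint α x∈i x∈i₀) i≢i₀
    rectangle-saturated-L-X (i , _) j {just _} {just _}
      (just ((k , _) , _) , (x∈k , refl) , (x′∈k , refl)) (x∈i , y∈j) =
      block-closed α x∈i (k , x∈k , x′∈k) , y∈j

    rectangle-saturated-L-Y : ∀ i ((j , _) : Index β ∖ proj₁ (cover β y₀)) →
                              Saturated (Rectangle i j) (L-Y β)
    rectangle-saturated-L-Y i (j , j≢j₀) {just _} (nothing , y∈j₀ , _) (_ , y∈j) =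
      contradiction (disjoint β y∈j y∈j₀) j≢j₀
    rectangle-saturated-L-Y i (j , _) {just _} {just _}
      (just (_ , (k , _)) , (refl , y∈k) , (refl , y′∈k)) (x∈i , y∈j) =
      x∈i , block-closed β y∈j (k , y∈k , y′∈k)

    otherBlocks⇒⊙-≉𝟏 : Index α ∖ proj₁ (cover α x₀) → Index β ∖ proj₁ (cover β y₀) →
                        ¬ (α ⊙ β ≈ 𝟏 z₀)
    otherBlocks⇒⊙-≉𝟏 i j =
      saturated⇒∨-≉𝟏 (rectangle? (proj₁ i) (proj₁ j)) {proj₁ (rectangle-nonempty i j)} {z₀}
        (proj₂ (rectangle-nonempty i j)) (λ ()) finZ (L-X α) (L-Y β) z₀
        (λ {u} {v} → rectangle-saturated-L-X i (proj₁ j) {u} {v})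
        (λ {u} {v} → rectangle-saturated-L-Y (proj₁ i) j {u} {v})

    ⊙-≈𝟏⁻ : α ⊙ β ≈ 𝟏 z₀ → α ≈ 𝟏 x₀ ⊎ β ≈ 𝟏 y₀
    ⊙-≈𝟏⁻ eq with ≈𝟏-or-otherBlock α finX x₀ | ≈𝟏-or-otherBlock β finY y₀
    ... | inj₁ α≈𝟏 | _        = inj₁ α≈𝟏
    ... | inj₂ _   | inj₁ β≈𝟏 = inj₂ β≈𝟏
    ... | inj₂ i   | inj₂ j   = contradiction eq (otherBlocks⇒⊙-≉𝟏 i j)

    -- A single lift already joins every point to `z₀`, and the join is coarser than either lift.
    ⊙-≈𝟏⁺ : α ≈ 𝟏 x₀ ⊎ β ≈ 𝟏 y₀ → α ⊙ β ≈ 𝟏 z₀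
    ⊙-≈𝟏⁺ eq = ∼⇒≈𝟏 (α ⊙ β) z₀ λ z →
      [ (λ p → ⪯⇒∼ {π = L-X α} {α ⊙ β} (proj₁ upper) (L-X-𝟏 α p z))
      , (λ q → ⪯⇒∼ {π = L-Y β} {α ⊙ β} (proj₁ (proj₂ upper)) (L-Y-𝟏 β q z)) ] eq
      where upper = ∨-supremum (L-X α) (L-Y β)

theorem4p3 : {X Y : Set} (finX : Finite X) (x₀ : X) (finY : Finite Y) (y₀ : Y) →
    let open PointedLift finX x₀ finY y₀ in
    (α : Part X) (β : Part Y) →
    (α ⊙ β ≈ 𝟏 z₀) ⇔ (α ≈ 𝟏 x₀ ⊎ β ≈ 𝟏 y₀)
theorem4p3 finX x₀ finY y₀ α β =
  mk⇔ (⊙-≈𝟏⁻ finX x₀ finY y₀ α β) (⊙-≈𝟏⁺ finX x₀ finY y₀ α β)
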